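{- Let $n$ be a positive integer, let $\lambda$ be a partition with at most $n$ nonzero parts, and let $\beta$ be a nonzero complex number. Then $$G_\lambda(\beta,\beta,\dots,\beta\mid -\beta^{ -1})=\beta^{|\lambda|},$$ where all $n$ variables are specialized to $\beta$.
   Context: A partition $\lambda$ is identified with its Young diagram $\{(i,j)\in\mathbb{Z}_{>0}^2 : j\le\lambda_i\}$ and $|\lambda|=\sum_i\lambda_i$. A set-valued tableau of shape $\lambda$ with entries in $[n]=\{1,\dots,n\}$ assigns a non-empty subset $T_{i,j}\subseteq[n]$ to each box $(i,j)\in\lambda$ such that $\max T_{i,j}\le\min T_{i,j+1}$ whenever $(i,j),(i,j+1)\in\lambda$ and $\max T_{i,j}<\min T_{i+1,j}$ whenever $(i,j),(i+1,j)\in\lambda$; $\mathrm{SVT}(\lambda,n)$ is the set of these. For such $T$, $|T|=\sum_{(i,j)}|T_{i,j}|$, $\omega_k(T)$ is the number of boxes whose set contains $k$, and $x^{\omega(T)}=\prod_{k=1}^n x_k^{\omega_k(T)}$. The stable Grothendieck polynomial is $G_\lambda(x_1,\dots,x_n\mid\beta)=\sum_{T\in\mathrm{SVT}(\lambda,n)}\beta^{|T|-|\lambda|}x^{\omega(T)}$. -}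

module Defs where

open import Algebra.Apartness.Bundles using (HeytingCommutativeRing; HeytingField)
open import Algebra.Bundles using (CommutativeRing; Semiring)
import Algebra.Apartness.Properties.HeytingCommutativeRing as HeytingProperties
import Algebra.Definitions.RawSemiring as RawSemiringDefinitions
open import Data.Fin.Base using (Fin; zero; suc; toℕ)
open import Data.Fin.Properties using (all?)
open import Data.Fin.Subset using (Subset; inside; outside; ∣_∣; _∈_; Nonempty)
open import Data.Fin.Subset.Properties using (_∈?_; nonempty?)
open import Data.List.Base as List
  using (List; []; _∷_; _++_; length; map; filter; foldr; allFin; cartesianProductWith)
import Data.List.Extrema.Nat as Extrema
open import Data.List.Relation.Unary.All using (All; []; _∷_)
open import Data.List.Relation.Unary.Linked using (Linked)
open import Data.Nat.Base using (ℕ; zero; suc; _∸_; _≤_; _<_; _≥_)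
open import Data.Nat.ListAction using (sum)
open import Data.Nat.Properties using (_≟_; _≤?_; _<?_)
open import Data.Product.Base using (_×_; proj₁; proj₂)
open import Data.Vec.Base as Vec using (Vec; []; _∷_)
open import Data.Vec.Functional using (Vector)
open import Relation.Binary.PropositionalEquality.Core using (_≡_)
open import Relation.Nullary.Decidable using (Dec; _×-dec_; _→-dec_)

------------------------------------------------------------------------
-- Partitions

-- Only the nonzero parts are stored, so the number of nonzero parts is
-- the length of the list.
record Partition : Set where
  field
    parts      : List ℕ
    decreasing : Linked _≥_ parts
    positive   : All (0 <_) parts

  size : ℕ
  size = sum parts

  numParts : ℕ
  numParts = length parts

------------------------------------------------------------------------
-- Fillings of a diagram by subsets of [n]

-- The element k : Fin n stands for toℕ k + 1 ∈ [n] = {1, …, n}.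

elements : ∀ {n} → Subset n → List ℕ
elements p = map toℕ (filter (_∈? p) (allFin _))

-- The minimum and maximum of a subset, correct when it is nonempty.  The
-- first argument to Extrema.min and Extrema.max is the value on the empty
-- list; it does not affect nonempty subsets because their elements lie
-- between 0 and n.
minimum maximum : ∀ {n} → Subset n → ℕ
minimum {n} p = Extrema.min n (elements p)
maximum     p = Extrema.max 0 (elements p)

-- A list of rows, the i-th being a vector of length λᵢ.
Filling : ℕ → List ℕ → Set
Filling n = All (Vec (Subset n))

-- Rows and columns are numbered from 0.
entry : ∀ {n rs} → Filling n rs →
        (i : Fin (length rs)) → Fin (List.lookup rs i) → Subset n
entry (r ∷ T) zero    j = Vec.lookup r j
entry (r ∷ T) (suc i) j = entry T i j

boxes : ∀ {n rs} → Filling n rs → List (Subset n)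
boxes []      = []
boxes (r ∷ T) = Vec.toList r ++ boxes T

-- |T|
weight : ∀ {n rs} → Filling n rs → ℕ
weight T = sum (map ∣_∣ (boxes T))

-- ωₖ(T)
ω : ∀ {n rs} → Filling n rs → Fin n → ℕ
ω T k = length (filter (k ∈?_) (boxes T))

------------------------------------------------------------------------
-- Set-valued tableaux

module _ {n rs} (T : Filling n rs) where

  NonemptyEntries : Set
  NonemptyEntries = ∀ i j → Nonempty (entry T i j)

  RowCondition : Set
  RowCondition = ∀ i j j′ → toℕ j′ ≡ suc (toℕ j) →
    maximum (entry T i j) ≤ minimum (entry T i j′)

  ColumnCondition : Set
  ColumnCondition = ∀ i i′ j j′ → toℕ i′ ≡ suc (toℕ i) → toℕ j′ ≡ toℕ j →
    maximum (entry T i j) < minimum (entry T i′ j′)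

  IsSetValuedTableau : Set
  IsSetValuedTableau = NonemptyEntries × RowCondition × ColumnCondition

  isSetValuedTableau? : Dec IsSetValuedTableau
  isSetValuedTableau? =
    (all? λ i → all? λ j → nonempty? (entry T i j))
    ×-dec (all? λ i → all? λ j → all? λ j′ →
      (toℕ j′ ≟ suc (toℕ j)) →-dec
      (maximum (entry T i j) ≤? minimum (entry T i j′)))
    ×-dec (all? λ i → all? λ i′ → all? λ j → all? λ j′ →
      (toℕ i′ ≟ suc (toℕ i)) →-dec (toℕ j′ ≟ toℕ j) →-dec
      (maximum (entry T i j) <? minimum (entry T i′ j′)))

-- If xs has no repetitions, vectors xs m lists each vector of length m with
-- entries in xs exactly once; hence subsets n lists each subset of [n], and
-- fillings n rs each filling, exactly once.

vectors : ∀ {a} {A : Set a} → List A → (m : ℕ) → List (Vec A m)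
vectors xs zero    = [] ∷ []
vectors xs (suc m) = cartesianProductWith _∷_ xs (vectors xs m)

subsets : ∀ n → List (Subset n)
subsets = vectors (outside ∷ inside ∷ [])

fillings : ∀ n rs → List (Filling n rs)
fillings n []       = [] ∷ []
fillings n (r ∷ rs) = cartesianProductWith _∷_ (vectors (subsets n) r) (fillings n rs)

SVT : (μ : Partition) (n : ℕ) → List (Filling n (Partition.parts μ))
SVT μ n = filter isSetValuedTableau? (fillings n (Partition.parts μ))

------------------------------------------------------------------------
-- Stable Grothendieck polynomials, evaluated in a commutative ring

module Grothendieck {c ℓ} (R : CommutativeRing c ℓ) where

  open CommutativeRing R
  open RawSemiringDefinitions (Semiring.rawSemiring semiring) using (_^_; product)

  -- The truncated subtraction is exact: the entries of a set-valued
  -- tableau are nonempty, so size μ ≤ weight T.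
  G : (μ : Partition) {n : ℕ} → Vector Carrier n → Carrier → Carrier
  G μ {n} x β = foldr _+_ 0# (map term (SVT μ n))
    where
    term : Filling n (Partition.parts μ) → Carrier
    term T = β ^ (weight T ∸ Partition.size μ) * product (λ k → x k ^ ω T k)

------------------------------------------------------------------------
-- Fields

-- The standard library has no complex numbers; ℂ is one instance of
-- HeytingField, and x # 0# is its positive form of "x is nonzero".
module Field {c ℓ₁ ℓ₂} (F : HeytingField c ℓ₁ ℓ₂) where

  open HeytingField F public
  open HeytingCommutativeRing heytingCommutativeRing using (commutativeRing)
  open CommutativeRing commutativeRing using (semiring)
  open RawSemiringDefinitions (Semiring.rawSemiring semiring) public using (_^_)
  open Grothendieck commutativeRing public using (G)
  open HeytingProperties heytingCommutativeRing using (x-0≈x)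

  inverse : ∀ {x} → x # 0# → Carrier
  inverse x#0 = proj₁ (#⇒invertible x#0)

  -- #⇒invertible inverts x - 0#, which is x.
  *-inverseʳ : ∀ {x} (x#0 : x # 0#) → x * inverse x#0 ≈ 1#
  *-inverseʳ {x} x#0 =
    trans (*-congʳ (sym (x-0≈x x))) (proj₂ (proj₂ (#⇒invertible x#0)))

{-# OPTIONS --safe #-}

-- Since |T| counts the pairs (box, element), specializing the variables to β
-- turns the term of T into β^|λ| (-1)^(|T|-|λ|), so the signed number of
-- set-valued tableaux has to be 1.  Let T be a tableau other than the one with
-- {i} in every box of row i, and take the first box, in reading order, whose
-- set is not {i}, where i is its row.  Adding or removing i in this set gives
-- another tableau with the same first box: the sets in the boxes to the left
-- and above are {i} and {i-1}, and column strictness forces the elements of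
-- every row m to be at least m.  This involution reverses the sign.
module Submission where

open import Defs
open import Algebra.Apartness.Bundles using (HeytingField; module HeytingCommutativeRing)
open import Algebra.Bundles using (CommutativeRing; Semiring)
import Algebra.Definitions.RawSemiring as RawSemiringDefinitions
import Algebra.Properties.CommutativeMonoid.Sum as CommutativeMonoidSum
import Algebra.Properties.CommutativeSemigroup as CommutativeSemigroupProperties
import Algebra.Properties.Ring as RingProperties
import Algebra.Properties.Semiring.Exp as Exp
open import Data.Bool.Base using (true; false; if_then_else_)
open import Data.Fin.Base using (Fin; zero; suc; toℕ; inject₁; inject≤; fromℕ<)
open import Data.Fin.Induction using (<-weakInduction)
open import Data.Fin.Properties
  using (toℕ-injective; toℕ-inject₁; toℕ-inject≤; toℕ-fromℕ<; toℕ<n; toℕ≤n)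
open import Data.Fin.Subset
  using (Subset; inside; outside; ∣_∣; _∈_; _∉_; Nonempty; ⊥; ⁅_⁆; _∪_)
open import Data.Fin.Subset.Properties
  using ( _∈?_; ∉⊥; drop-there; ∪-identityˡ; ∪-identityʳ
        ; x∈p∪q⁺; x∈p∪q⁻; x∈⁅x⁆; x∈⁅y⁆⇒x≡y; ∣⁅x⁆∣≡1)
open import Data.List.Base as List
  using (List; []; _∷_; _++_; length; map; filter; foldr; allFin; cartesianProductWith)
import Data.List.Extrema.Nat as Extrema
open import Data.List.Membership.Propositional.Properties using (∈-map⁺; ∈-filter⁺; ∈-allFin)
open import Data.List.Properties using (map-++)
open import Data.List.Relation.Unary.All as All using (All; []; _∷_)
import Data.List.Relation.Unary.All.Properties as All
open import Data.List.Relation.Unary.Linked using (Linked; _∷_)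
open import Data.Nat.Base as ℕ using (ℕ; zero; suc; _∸_; _≤_; _<_; _≥_; NonZero; z≤n; s≤s)
open import Data.Nat.ListAction using (sum)
open import Data.Nat.ListAction.Properties using (sum-++)
open import Data.Nat.Properties as ℕ
  using (≤-reflexive; ≤-trans; <-≤-trans; module ≤-Reasoning)
open import Data.Product.Base using (_×_; _,_; proj₁; proj₂)
open import Data.Sum.Base as Sum using (_⊎_; inj₁; inj₂)
open import Data.Vec.Base as Vec using (Vec; []; _∷_; here; there)
open import Data.Vec.Properties using (lookup-replicate)
open import Function.Base using (_∘_)
open import Relation.Binary.PropositionalEquality as ≡ using (_≡_; cong; subst)
open import Relation.Nullary using (Dec; yes; no; does; ¬_; contradiction)
import Relation.Binary.Reasoning.Setoid as SetoidReasoning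

private
  variable
    n r : ℕ
    rs  : List ℕ

-- Subsets of [n]

∣p∪⁅i⁆∣ : ∀ (p : Subset n) i → i ∉ p → ∣ p ∪ ⁅ i ⁆ ∣ ≡ suc ∣ p ∣
∣p∪⁅i⁆∣ (inside  ∷ p) zero    i∉p = contradiction here i∉p
∣p∪⁅i⁆∣ (outside ∷ p) zero    i∉p = cong (suc ∘ ∣_∣) (∪-identityʳ p)
∣p∪⁅i⁆∣ (inside  ∷ p) (suc i) i∉p = cong suc (∣p∪⁅i⁆∣ p i (i∉p ∘ there))
∣p∪⁅i⁆∣ (outside ∷ p) (suc i) i∉p = ∣p∪⁅i⁆∣ p i (i∉p ∘ there)

nonempty⇒0<∣p∣ : ∀ {p : Subset n} → Nonempty p → 0 < ∣ p ∣
nonempty⇒0<∣p∣ {p = inside  ∷ p} _                 = s≤s z≤n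
nonempty⇒0<∣p∣ {p = outside ∷ p} (suc k , there k∈p) = nonempty⇒0<∣p∣ (k , k∈p)

module _ {p : Subset n} where

  all-elements : ∀ {P : ℕ → Set} → (∀ {k} → k ∈ p → P (toℕ k)) → All P (elements p)
  all-elements Pp = All.map⁺ (All.map Pp (All.all-filter (_∈? p) (allFin n)))

  elements-all : ∀ {P : ℕ → Set} → All P (elements p) → ∀ {k} → k ∈ p → P (toℕ k)
  elements-all Ps {k} k∈p = All.lookup Ps (∈-map⁺ toℕ (∈-filter⁺ (_∈? p) (∈-allFin k) k∈p))

  toℕ≤maximum : ∀ {k} → k ∈ p → toℕ k ≤ maximum p
  toℕ≤maximum = elements-all (Extrema.xs≤max 0 (elements p))

  minimum≤toℕ : ∀ {k} → k ∈ p → minimum p ≤ toℕ k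
  minimum≤toℕ = elements-all (Extrema.min≤xs n (elements p))

  maximum≤ : ∀ {m} → (∀ {k} → k ∈ p → toℕ k ≤ m) → maximum p ≤ m
  maximum≤ p≤m = Extrema.max≤v⁺ z≤n (all-elements p≤m)

  -- Positivity of `m` accounts for the empty set, whose `maximum` is 0 by default.
  maximum< : ∀ {m} → 0 < m → (∀ {k} → k ∈ p → toℕ k < m) → maximum p < m
  maximum< 0<m p<m = Extrema.max<v⁺ 0<m (all-elements p<m)

  ≤minimum : ∀ {m} → m ≤ n → (∀ {k} → k ∈ p → m ≤ toℕ k) → m ≤ minimum p
  ≤minimum m≤n m≤p = Extrema.v≤min⁺ m≤n (all-elements m≤p)

module _ {p q : Subset n} where

  maximum≤minimum : (∀ {k l} → k ∈ p → l ∈ q → toℕ k ≤ toℕ l) → maximum p ≤ minimum q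
  maximum≤minimum p≤q =
    ≤minimum (maximum≤ λ {k} _ → toℕ≤n k) λ l∈q → maximum≤ λ k∈p → p≤q k∈p l∈q

  -- If `q` is empty, its minimum is the default `n`, which exceeds every element of `p`. The member
  -- `m` of `p` supplies the positivity that `maximum<` asks for: `n` is positive because `m` lies
  -- in `Fin n`, and each `l` in `q` because `m` is smaller.
  maximum<minimum : Nonempty p → (∀ {k l} → k ∈ p → l ∈ q → toℕ k < toℕ l) →
                    maximum p < minimum q
  maximum<minimum (m , m∈p) p<q =
    ≤minimum (maximum< (≤-trans (s≤s z≤n) (toℕ<n m)) λ {k} _ → toℕ<n k)
      λ l∈q → maximum< (≤-trans (s≤s z≤n) (p<q m∈p l∈q)) λ k∈p → p<q k∈p l∈q

-- Set-valued tableaux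

-- Comparing all pairs of elements, instead of extrema, lets an insertion be checked by asking of
-- each element whether it is old or new.
Elementwise : Filling n rs → Set
Elementwise T =
  NonemptyEntries T ×
  (∀ i j j′ → toℕ j′ ≡ suc (toℕ j) →
    ∀ {k l} → k ∈ entry T i j → l ∈ entry T i j′ → toℕ k ≤ toℕ l) ×
  (∀ i i′ j j′ → toℕ i′ ≡ suc (toℕ i) → toℕ j′ ≡ toℕ j →
    ∀ {k l} → k ∈ entry T i j → l ∈ entry T i′ j′ → toℕ k < toℕ l)

module _ (T : Filling n rs) where

  toElementwise : IsSetValuedTableau T → Elementwise T
  toElementwise (nonempty , row , column) =
    nonempty ,
    (λ i j j′ j→j′ k∈ l∈ →
      ≤-trans (toℕ≤maximum k∈) (≤-trans (row i j j′ j→j′) (minimum≤toℕ l∈))) ,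
    (λ i i′ j j′ i→i′ j≡j′ k∈ l∈ →
      ≤-trans (s≤s (toℕ≤maximum k∈))
        (≤-trans (column i i′ j j′ i→i′ j≡j′) (minimum≤toℕ l∈)))

  fromElementwise : Elementwise T → IsSetValuedTableau T
  fromElementwise (nonempty , row , column) =
    nonempty ,
    (λ i j j′ j→j′ → maximum≤minimum (row i j j′ j→j′)) ,
    (λ i i′ j j′ i→i′ j≡j′ → maximum<minimum (nonempty i j) (column i i′ j j′ i→i′ j≡j′))

lookup-linked : ∀ {r} → Linked _≥_ (r ∷ rs) →
                ∀ i → List.lookup rs i ≤ List.lookup (r ∷ rs) (inject₁ i)
lookup-linked (r≥s ∷ _)  zero    = r≥s
lookup-linked (_ ∷ rs↘) (suc i) = lookup-linked rs↘ i

-- Induction down the rows. Rows weakly shorten, so each box below row 0 has a box directly above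
-- it; that box has some element, bounded by induction, and column strictness raises the bound by
-- one.
rowIndex≤ : Linked _≥_ rs → (T : Filling n rs) → Elementwise T →
            ∀ i j {k} → k ∈ entry T i j → toℕ i ≤ toℕ k
rowIndex≤ {rs = r ∷ rs} rs↘ T (nonempty , _ , column) =
  <-weakInduction (λ i → ∀ j {k} → k ∈ entry T i j → toℕ i ≤ toℕ k)
    (λ _ _ → z≤n)
    λ i i≤ j k∈ →
      let j<     = <-≤-trans (toℕ<n j) (lookup-linked rs↘ i)
          j₁     = fromℕ< j<
          l , l∈ = nonempty (inject₁ i) j₁
      in ≤-trans
           (s≤s (subst (_≤ toℕ l) (toℕ-inject₁ i) (i≤ j₁ l∈)))
           (column (inject₁ i) (suc i) j₁ j
             (cong suc (≡.sym (toℕ-inject₁ i))) (≡.sym (toℕ-fromℕ< j<)) l∈ k∈)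

-- Inserting an element into a box

insertRow : Vec (Subset n) r → Fin r → Fin n → Vec (Subset n) r
insertRow v j k = Vec.updateAt v j (_∪ ⁅ k ⁆)

-- Only this half of the involution is formed: each pair is represented by the filling whose box
-- lacks the element.
insert : (T : Filling n rs) (i : Fin (length rs)) → Fin (List.lookup rs i) → Fin n →
         Filling n rs
insert (v ∷ T) zero    j k = insertRow v j k ∷ T
insert (v ∷ T) (suc i) j k = v ∷ insert T i j k

∈-insertRow⁺ : ∀ (v : Vec (Subset n) r) j k j′ {l} →
               l ∈ Vec.lookup v j′ → l ∈ Vec.lookup (insertRow v j k) j′
∈-insertRow⁺ (p ∷ v) zero    k zero     l∈ = x∈p∪q⁺ (inj₁ l∈)
∈-insertRow⁺ (p ∷ v) zero    k (suc j′) l∈ = l∈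
∈-insertRow⁺ (p ∷ v) (suc j) k zero     l∈ = l∈
∈-insertRow⁺ (p ∷ v) (suc j) k (suc j′) l∈ = ∈-insertRow⁺ v j k j′ l∈

∈-insertRow⁻ : ∀ (v : Vec (Subset n) r) j k j′ {l} →
               l ∈ Vec.lookup (insertRow v j k) j′ →
               l ∈ Vec.lookup v j′ ⊎ (toℕ j′ ≡ toℕ j × l ≡ k)
∈-insertRow⁻ (p ∷ v) zero    k zero     l∈ =
  Sum.map₂ (λ l∈k → ≡.refl , x∈⁅y⁆⇒x≡y k l∈k) (x∈p∪q⁻ p ⁅ k ⁆ l∈)
∈-insertRow⁻ (p ∷ v) zero    k (suc j′) l∈ = inj₁ l∈
∈-insertRow⁻ (p ∷ v) (suc j) k zero     l∈ = inj₁ l∈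
∈-insertRow⁻ (p ∷ v) (suc j) k (suc j′) l∈ =
  Sum.map₂ (λ (j′≡j , l≡k) → cong suc j′≡j , l≡k) (∈-insertRow⁻ v j k j′ l∈)

∈-insert⁺ : ∀ (T : Filling n rs) i j k i′ j′ {l} →
            l ∈ entry T i′ j′ → l ∈ entry (insert T i j k) i′ j′
∈-insert⁺ (v ∷ T) zero    j k zero     j′ l∈ = ∈-insertRow⁺ v j k j′ l∈
∈-insert⁺ (v ∷ T) zero    j k (suc i′) j′ l∈ = l∈
∈-insert⁺ (v ∷ T) (suc i) j k zero     j′ l∈ = l∈
∈-insert⁺ (v ∷ T) (suc i) j k (suc i′) j′ l∈ = ∈-insert⁺ T i j k i′ j′ l∈

-- Columns are compared through `toℕ`, because the types of `j` and `j′` depend on the rows `i` and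
-- `i′`.
∈-insert⁻ : ∀ (T : Filling n rs) i j k i′ j′ {l} →
            l ∈ entry (insert T i j k) i′ j′ →
            l ∈ entry T i′ j′ ⊎ (i′ ≡ i × toℕ j′ ≡ toℕ j × l ≡ k)
∈-insert⁻ (v ∷ T) zero    j k zero     j′ l∈ = Sum.map₂ (≡.refl ,_) (∈-insertRow⁻ v j k j′ l∈)
∈-insert⁻ (v ∷ T) zero    j k (suc i′) j′ l∈ = inj₁ l∈
∈-insert⁻ (v ∷ T) (suc i) j k zero     j′ l∈ = inj₁ l∈
∈-insert⁻ (v ∷ T) (suc i) j k (suc i′) j′ l∈ =
  Sum.map₂ (λ (i′≡i , eqs) → cong suc i′≡i , eqs) (∈-insert⁻ T i j k i′ j′ l∈)

-- Weights of rows and fillings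

rowWeight : Vec (Subset n) r → ℕ
rowWeight v = sum (map ∣_∣ (Vec.toList v))

weight-∷ : ∀ (v : Vec (Subset n) r) (T : Filling n rs) →
           weight (v ∷ T) ≡ rowWeight v ℕ.+ weight T
weight-∷ v T = ≡.trans (cong sum (map-++ ∣_∣ (Vec.toList v) (boxes T)))
                       (sum-++ (map ∣_∣ (Vec.toList v)) (map ∣_∣ (boxes T)))

rowWeight-insert : ∀ (v : Vec (Subset n) r) j k → k ∉ Vec.lookup v j →
                   rowWeight (insertRow v j k) ≡ suc (rowWeight v)
rowWeight-insert (p ∷ v) zero    k k∉ = cong (ℕ._+ rowWeight v) (∣p∪⁅i⁆∣ p k k∉)
rowWeight-insert (p ∷ v) (suc j) k k∉ =
  ≡.trans (cong (∣ p ∣ ℕ.+_) (rowWeight-insert v j k k∉)) (ℕ.+-suc ∣ p ∣ (rowWeight v))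

weight-insert : ∀ (T : Filling n rs) i j k → k ∉ entry T i j →
                weight (insert T i j k) ≡ suc (weight T)
weight-insert (v ∷ T) zero j k k∉ = begin
  weight (insertRow v j k ∷ T)              ≡⟨ weight-∷ (insertRow v j k) T ⟩
  rowWeight (insertRow v j k) ℕ.+ weight T  ≡⟨ cong (ℕ._+ weight T) (rowWeight-insert v j k k∉) ⟩
  suc (rowWeight v ℕ.+ weight T)            ≡⟨ cong suc (weight-∷ v T) ⟨
  suc (weight (v ∷ T))                      ∎
  where open ≡.≡-Reasoning
weight-insert (v ∷ T) (suc i) j k k∉ = begin
  weight (v ∷ insert T i j k)               ≡⟨ weight-∷ v (insert T i j k) ⟩
  rowWeight v ℕ.+ weight (insert T i j k)   ≡⟨ cong (rowWeight v ℕ.+_) (weight-insert T i j k k∉) ⟩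
  rowWeight v ℕ.+ suc (weight T)            ≡⟨ ℕ.+-suc (rowWeight v) (weight T) ⟩
  suc (rowWeight v ℕ.+ weight T)            ≡⟨ cong suc (weight-∷ v T) ⟨
  suc (weight (v ∷ T))                      ∎
  where open ≡.≡-Reasoning

length≤rowWeight : (v : Vec (Subset n) r) → (∀ j → Nonempty (Vec.lookup v j)) →
                   r ≤ rowWeight v
length≤rowWeight []      _        = z≤n
length≤rowWeight (p ∷ v) nonempty =
  ℕ.+-mono-≤ (nonempty⇒0<∣p∣ (nonempty zero)) (length≤rowWeight v (nonempty ∘ suc))

-- This makes the truncated exponent of a term exact, so that it grows by one under insertion.
size≤weight : (T : Filling n rs) → NonemptyEntries T → sum rs ≤ weight T
size≤weight []                    _        = z≤n
size≤weight {rs = r ∷ rs} (v ∷ T) nonempty = begin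
  r ℕ.+ sum rs              ≤⟨ ℕ.+-mono-≤ (length≤rowWeight v (nonempty zero))
                                          (size≤weight T (nonempty ∘ suc)) ⟩
  rowWeight v ℕ.+ weight T  ≡⟨ weight-∷ v T ⟨
  weight (v ∷ T)            ∎
  where open ≤-Reasoning

-- The filling with {c i} in every box of row i

constantRows : ∀ rs → (Fin (length rs) → Fin n) → Filling n rs
constantRows []       c = []
constantRows (r ∷ rs) c = Vec.replicate r ⁅ c zero ⁆ ∷ constantRows rs (c ∘ suc)

entry-constantRows : ∀ rs (c : Fin (length rs) → Fin n) i j →
                     entry (constantRows rs c) i j ≡ ⁅ c i ⁆
entry-constantRows (r ∷ rs) c zero    j = lookup-replicate j ⁅ c zero ⁆
entry-constantRows (r ∷ rs) c (suc i) j = entry-constantRows rs (c ∘ suc) i j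

rowWeight-replicate : ∀ r (k : Fin n) → rowWeight (Vec.replicate r ⁅ k ⁆) ≡ r
rowWeight-replicate zero    k = ≡.refl
rowWeight-replicate (suc r) k = ≡.cong₂ ℕ._+_ (∣⁅x⁆∣≡1 k) (rowWeight-replicate r k)

weight-constantRows : ∀ rs (c : Fin (length rs) → Fin n) → weight (constantRows rs c) ≡ sum rs
weight-constantRows []       c = ≡.refl
weight-constantRows (r ∷ rs) c =
  ≡.trans (weight-∷ (Vec.replicate r ⁅ c zero ⁆) (constantRows rs (c ∘ suc)))
    (≡.cong₂ ℕ._+_ (rowWeight-replicate r (c zero)) (weight-constantRows rs (c ∘ suc)))

-- Every box that precedes (i, j) in reading order agrees with `constantRows rs c`. Nothing is asked
-- of the box (i, j) itself, so the condition is shared by both members of a pair.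
record ConstantBefore (c : Fin (length rs) → Fin n) (T : Filling n rs)
                      (i : Fin (length rs)) (j : Fin (List.lookup rs i)) : Set where
  field
    above : ∀ i′ j′ → toℕ i′ < toℕ i → entry T i′ j′ ≡ ⁅ c i′ ⁆
    left  : ∀ j′ → toℕ j′ < toℕ j → entry T i j′ ≡ ⁅ c i ⁆

-- Passing to smaller sets preserves all comparisons. Only nonemptiness could be lost, and only in
-- the box (i, j), where it is assumed.
insert-tableau⁻ : ∀ (T : Filling n rs) i j k → Nonempty (entry T i j) →
                  IsSetValuedTableau (insert T i j k) → IsSetValuedTableau T
insert-tableau⁻ T i j k nonempty tableau = fromElementwise T
  ( nonempty′
  , (λ i′ j₁ j₂ j₁→j₂ k∈ l∈ →
      row i′ j₁ j₂ j₁→j₂ (∈-insert⁺ T i j k i′ j₁ k∈) (∈-insert⁺ T i j k i′ j₂ l∈))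
  , (λ i₁ i₂ j₁ j₂ i₁→i₂ j₁≡j₂ k∈ l∈ →
      column i₁ i₂ j₁ j₂ i₁→i₂ j₁≡j₂ (∈-insert⁺ T i j k i₁ j₁ k∈) (∈-insert⁺ T i j k i₂ j₂ l∈)))
  where
  elementwise = toElementwise (insert T i j k) tableau
  row         = proj₁ (proj₂ elementwise)
  column      = proj₂ (proj₂ elementwise)

  nonempty′ : NonemptyEntries T
  nonempty′ i′ j′ with proj₁ elementwise i′ j′
  ... | l , l∈ with ∈-insert⁻ T i j k i′ j′ l∈
  ...   | inj₁ l∈ = l , l∈
  ...   | inj₂ (≡.refl , j′≡j , _) =
    subst (Nonempty ∘ entry T i) (≡.sym (toℕ-injective j′≡j)) nonempty

module _ {rs} (rs↘ : Linked _≥_ rs) (c : Fin (length rs) → Fin n)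
         (toℕ-c : ∀ i → toℕ (c i) ≡ toℕ i) where

  private
    toℕ-∈⁅c⁆ : ∀ {p i k} → p ≡ ⁅ c i ⁆ → k ∈ p → toℕ k ≡ toℕ i
    toℕ-∈⁅c⁆ {i = i} ≡.refl k∈ = ≡.trans (cong toℕ (x∈⁅y⁆⇒x≡y (c i) k∈)) (toℕ-c i)

  constantRows-tableau : IsSetValuedTableau (constantRows rs c)
  constantRows-tableau = fromElementwise (constantRows rs c)
    ( (λ i j → c i , subst (c i ∈_) (≡.sym (entry-constantRows rs c i j)) (x∈⁅x⁆ (c i)))
    , (λ i j j′ _ k∈ l∈ → ≤-reflexive
        (≡.trans (toℕ-∈⁅c⁆ (entry-constantRows rs c i j) k∈)
                 (≡.sym (toℕ-∈⁅c⁆ (entry-constantRows rs c i j′) l∈))))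
    , (λ i i′ j j′ i→i′ _ k∈ l∈ → ≤-reflexive
        (≡.trans (cong suc (toℕ-∈⁅c⁆ (entry-constantRows rs c i j) k∈))
          (≡.trans (≡.sym i→i′) (≡.sym (toℕ-∈⁅c⁆ (entry-constantRows rs c i′ j′) l∈))))))

  module _ (T : Filling n rs) (i : Fin (length rs)) (j : Fin (List.lookup rs i)) where

    -- The new element has value `i`. To the right and below, elements are bounded below by their
    -- row index; the boxes to the left and above are the constant sets with values `i` and `i - 1`.
    insert-tableau : ConstantBefore c T i j →
                     IsSetValuedTableau T → IsSetValuedTableau (insert T i j (c i))
    insert-tableau before tableau = fromElementwise T′
      ( (λ i′ j′ → let k , k∈ = nonempty i′ j′ in k , ∈-insert⁺ T i j (c i) i′ j′ k∈)
      , row′ , column′ )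
      where
      open ConstantBefore before
      elementwise = toElementwise T tableau
      nonempty    = proj₁ elementwise
      row         = proj₁ (proj₂ elementwise)
      column      = proj₂ (proj₂ elementwise)
      T′          = insert T i j (c i)

      -- `rowIndex≤` cannot be applied to `T′`, which is not yet known to be a tableau; but the new
      -- element meets the bound with equality.
      rowIndex≤′ : ∀ i′ j′ {k} → k ∈ entry T′ i′ j′ → toℕ i′ ≤ toℕ k
      rowIndex≤′ i′ j′ k∈ with ∈-insert⁻ T i j (c i) i′ j′ k∈
      ... | inj₁ k∈                    = rowIndex≤ rs↘ T elementwise i′ j′ k∈
      ... | inj₂ (≡.refl , _ , ≡.refl) = ≤-reflexive (≡.sym (toℕ-c i))

      row′ : ∀ i′ j₁ j₂ → toℕ j₂ ≡ suc (toℕ j₁) → ∀ {k l} →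
             k ∈ entry T′ i′ j₁ → l ∈ entry T′ i′ j₂ → toℕ k ≤ toℕ l
      row′ i′ j₁ j₂ j₁→j₂ k∈ l∈
        with ∈-insert⁻ T i j (c i) i′ j₁ k∈ | ∈-insert⁻ T i j (c i) i′ j₂ l∈
      ... | inj₂ (≡.refl , _ , ≡.refl) | _       =
        subst (_≤ _) (≡.sym (toℕ-c i)) (rowIndex≤′ i j₂ l∈)
      ... | inj₁ k∈ | inj₁ l∈                    = row i′ j₁ j₂ j₁→j₂ k∈ l∈
      -- The box `j₁` is the left neighbour of the altered box, hence still the constant set.
      ... | inj₁ k∈ | inj₂ (≡.refl , j₂≡j , ≡.refl) = ≤-reflexive
        (≡.trans (toℕ-∈⁅c⁆ (left j₁ (≤-reflexive (≡.trans (≡.sym j₁→j₂) j₂≡j))) k∈)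
                 (≡.sym (toℕ-c i)))

      column′ : ∀ i₁ i₂ j₁ j₂ → toℕ i₂ ≡ suc (toℕ i₁) → toℕ j₂ ≡ toℕ j₁ → ∀ {k l} →
                k ∈ entry T′ i₁ j₁ → l ∈ entry T′ i₂ j₂ → toℕ k < toℕ l
      column′ i₁ i₂ j₁ j₂ i₁→i₂ j₁≡j₂ {k} {l} k∈ l∈
        with ∈-insert⁻ T i j (c i) i₁ j₁ k∈ | ∈-insert⁻ T i j (c i) i₂ j₂ l∈
      ... | inj₁ k∈ | inj₁ l∈ = column i₁ i₂ j₁ j₂ i₁→i₂ j₁≡j₂ k∈ l∈
      ... | inj₂ (≡.refl , _ , ≡.refl) | _ = begin-strict
        toℕ (c i)  ≡⟨ toℕ-c i ⟩
        toℕ i      <⟨ ≤-reflexive (≡.sym i₁→i₂) ⟩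
        toℕ i₂     ≤⟨ rowIndex≤′ i₂ j₂ l∈ ⟩
        toℕ l      ∎
        where open ≤-Reasoning
      ... | inj₁ k∈ | inj₂ (≡.refl , _ , ≡.refl) = begin-strict
        toℕ k      ≡⟨ toℕ-∈⁅c⁆ (above i₁ j₁ (≤-reflexive (≡.sym i₁→i₂))) k∈ ⟩
        toℕ i₁     <⟨ ≤-reflexive (≡.sym i₁→i₂) ⟩
        toℕ i      ≡⟨ toℕ-c i ⟨
        toℕ (c i)  ∎
        where open ≤-Reasoning

-- Finite sums

module Summation {c ℓ} (R : CommutativeRing c ℓ) where

  open CommutativeRing R hiding (zero)
  open CommutativeSemigroupProperties +-commutativeSemigroup using () renaming (interchange to +-interchange)
  open SetoidReasoning setoid

  private
    variable
      A B C : Set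

  ∑ : List A → (A → Carrier) → Carrier
  ∑ xs f = foldr _+_ 0# (map f xs)

  ∑-zero : ∀ (xs : List A) {f} → (∀ x → f x ≈ 0#) → ∑ xs f ≈ 0#
  ∑-zero []       f≈0 = refl
  ∑-zero (x ∷ xs) f≈0 = trans (+-cong (f≈0 x) (∑-zero xs f≈0)) (+-identityˡ 0#)

  ∑-distrib-+ : ∀ (xs : List A) f g → ∑ xs (λ x → f x + g x) ≈ ∑ xs f + ∑ xs g
  ∑-distrib-+ []       f g = sym (+-identityˡ 0#)
  ∑-distrib-+ (x ∷ xs) f g =
    trans (+-congˡ (∑-distrib-+ xs f g)) (+-interchange (f x) (g x) (∑ xs f) (∑ xs g))

  ∑-map-++ : ∀ (h : A → B) xs ys f → ∑ (map h xs ++ ys) f ≈ ∑ xs (f ∘ h) + ∑ ys f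
  ∑-map-++ h []       ys f = sym (+-identityˡ (∑ ys f))
  ∑-map-++ h (x ∷ xs) ys f =
    trans (+-congˡ (∑-map-++ h xs ys f)) (sym (+-assoc (f (h x)) (∑ xs (f ∘ h)) (∑ ys f)))

  ∑-cartesianProductWith : ∀ (h : A → B → C) xs ys f →
    ∑ (cartesianProductWith h xs ys) f ≈ ∑ xs λ x → ∑ ys λ y → f (h x y)
  ∑-cartesianProductWith h []       ys f = refl
  ∑-cartesianProductWith h (x ∷ xs) ys f =
    trans (∑-map-++ (h x) ys (cartesianProductWith h xs ys) f)
          (+-congˡ (∑-cartesianProductWith h xs ys f))

  -- Zero terms replace filtering, so that sums run over all fillings and split as iterated sums
  -- over boxes.
  when : ∀ {P : Set} → Dec P → Carrier → Carrier
  when P? x = if does P? then x else 0#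

  ∑-filter : ∀ {P : A → Set} (P? : ∀ x → Dec (P x)) xs f →
             ∑ (filter P? xs) f ≈ ∑ xs λ x → when (P? x) (f x)
  ∑-filter P? []       f = refl
  ∑-filter P? (x ∷ xs) f with does (P? x)
  ... | true  = +-congˡ (∑-filter P? xs f)
  ... | false = trans (∑-filter P? xs f) (sym (+-identityˡ _))

  when-yes : ∀ {P : Set} (P? : Dec P) {x} → P → when P? x ≈ x
  when-yes (yes _) p = refl
  when-yes (no ¬p) p = contradiction p ¬p

  when-no : ∀ {P : Set} (P? : Dec P) {x} → ¬ P → when P? x ≈ 0#
  when-no (yes p) ¬p = contradiction p ¬p
  when-no (no _)  ¬p = refl

  -- Applied with `P` and `Q` saying that the two fillings of a pair are tableaux: both terms count
  -- and cancel, or both are replaced by zero.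
  when-cancel : ∀ {P Q : Set} (P? : Dec P) (Q? : Dec Q) {x y} →
                (P → Q) → (Q → P) → (P → x + y ≈ 0#) → when P? x + when Q? y ≈ 0#
  when-cancel (yes p) (yes q) P→Q Q→P x+y≈0 = x+y≈0 p
  when-cancel (yes p) (no ¬q) P→Q Q→P x+y≈0 = contradiction (P→Q p) ¬q
  when-cancel (no ¬p) (yes q) P→Q Q→P x+y≈0 = contradiction (Q→P q) ¬p
  when-cancel (no ¬p) (no ¬q) P→Q Q→P x+y≈0 = +-identityˡ 0#

  -- Cancellation in sums over subsets, rows and fillings

  ∑-subsets-suc : ∀ n (f : Subset (suc n) → Carrier) →
    ∑ (subsets (suc n)) f ≈
    ∑ (subsets n) (f ∘ (outside ∷_)) + ∑ (subsets n) (f ∘ (inside ∷_))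
  ∑-subsets-suc n f =
    trans (∑-cartesianProductWith _∷_ (outside ∷ inside ∷ []) (subsets n) f)
          (+-congˡ (+-identityʳ _))

  ∑-subsets-⊥ : ∀ n (f : Subset n → Carrier) →
                (∀ p → Nonempty p → f p ≈ 0#) → ∑ (subsets n) f ≈ f ⊥
  ∑-subsets-⊥ zero    f f≈0 = +-identityʳ (f [])
  ∑-subsets-⊥ (suc n) f f≈0 = begin
    ∑ (subsets (suc n)) f        ≈⟨ ∑-subsets-suc n f ⟩
    ∑ (subsets n) (f ∘ (outside ∷_)) + ∑ (subsets n) (f ∘ (inside ∷_))
      ≈⟨ +-cong (∑-subsets-⊥ n _ λ p (k , k∈p) → f≈0 (outside ∷ p) (suc k , there k∈p))
                (∑-zero (subsets n) λ p → f≈0 (inside ∷ p) (zero , here)) ⟩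
    f ⊥ + 0#                     ≈⟨ +-identityʳ (f ⊥) ⟩
    f ⊥                          ∎

  -- Pairing `p` with its union with {i} leaves only the pair of the empty set and {i}. The
  -- induction on `i` ends at `zero`, where the two halves of the sum, without and with 0, are
  -- matched term by term.
  ∑-subsets-cancel : ∀ n (i : Fin n) (f : Subset n → Carrier) →
    (∀ p → i ∉ p → Nonempty p → f p + f (p ∪ ⁅ i ⁆) ≈ 0#) →
    ∑ (subsets n) f ≈ f ⊥ + f ⁅ i ⁆
  ∑-subsets-cancel (suc n) zero f cancel = begin
    ∑ (subsets (suc n)) f        ≈⟨ ∑-subsets-suc n f ⟩
    ∑ (subsets n) (f ∘ (outside ∷_)) + ∑ (subsets n) (f ∘ (inside ∷_))
      ≈⟨ ∑-distrib-+ (subsets n) _ _ ⟨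
    ∑ (subsets n) (λ p → f (outside ∷ p) + f (inside ∷ p))
      ≈⟨ ∑-subsets-⊥ n _ (λ p (k , k∈p) →
           subst (λ q → f (outside ∷ p) + f (inside ∷ q) ≈ 0#) (∪-identityʳ p)
             (cancel (outside ∷ p) (λ ()) (suc k , there k∈p))) ⟩
    f ⊥ + f ⁅ zero ⁆             ∎
  ∑-subsets-cancel (suc n) (suc i) f cancel = begin
    ∑ (subsets (suc n)) f        ≈⟨ ∑-subsets-suc n f ⟩
    ∑ (subsets n) (f ∘ (outside ∷_)) + ∑ (subsets n) (f ∘ (inside ∷_))
      ≈⟨ +-cong (∑-subsets-cancel n i _ λ p i∉p (k , k∈p) →
                   cancel (outside ∷ p) (i∉p ∘ drop-there) (suc k , there k∈p))
                (∑-subsets-cancel n i _ λ p i∉p _ →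
                   cancel (inside ∷ p) (i∉p ∘ drop-there) (zero , here)) ⟩
    (f ⊥ + f ⁅ suc i ⁆) + (f (inside ∷ ⊥) + f (inside ∷ ⁅ i ⁆))
      -- The pair left over from the half containing 0 is {0} and its union with {i + 1}; as {0} is
      -- nonempty, this pair cancels too.
      ≈⟨ +-congˡ (subst (λ q → f (inside ∷ ⊥) + f (inside ∷ q) ≈ 0#) (∪-identityˡ ⁅ i ⁆)
           (cancel (inside ∷ ⊥) (∉⊥ ∘ drop-there) (zero , here))) ⟩
    (f ⊥ + f ⁅ suc i ⁆) + 0#     ≈⟨ +-identityʳ _ ⟩
    f ⊥ + f ⁅ suc i ⁆            ∎

  -- Scans for the first box different from {k}. Summing over the leftmost box first, the inner sums
  -- for a nonempty `p` without `k` and for its union with {k} cancel. The empty set contributes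
  -- zero, so {k} remains and the scan moves right.
  ∑-rows-cancel : ∀ r (k : Fin n) (f : Vec (Subset n) r → Carrier) →
    (∀ v j → ¬ Nonempty (Vec.lookup v j) → f v ≈ 0#) →
    (∀ v j → (∀ j′ → toℕ j′ < toℕ j → Vec.lookup v j′ ≡ ⁅ k ⁆) →
      k ∉ Vec.lookup v j → Nonempty (Vec.lookup v j) → f v + f (insertRow v j k) ≈ 0#) →
    ∑ (vectors (subsets n) r) f ≈ f (Vec.replicate r ⁅ k ⁆)
  ∑-rows-cancel         zero    k f empty cancel = +-identityʳ (f [])
  ∑-rows-cancel {n = n} (suc r) k f empty cancel = begin
    ∑ (vectors (subsets n) (suc r)) f
      ≈⟨ ∑-cartesianProductWith _∷_ (subsets n) vs f ⟩
    ∑ (subsets n) (λ p → ∑ vs (f ∘ (p ∷_)))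
      ≈⟨ ∑-subsets-cancel n k _ (λ p k∉p nonempty →
           trans (sym (∑-distrib-+ vs _ _))
             (∑-zero vs λ v → cancel (p ∷ v) zero (λ _ ()) k∉p nonempty)) ⟩
    ∑ vs (f ∘ (⊥ ∷_)) + ∑ vs (f ∘ (⁅ k ⁆ ∷_))
      ≈⟨ +-cong (∑-zero vs λ v → empty (⊥ ∷ v) zero λ (_ , k∈⊥) → ∉⊥ k∈⊥)
                (∑-rows-cancel r k (f ∘ (⁅ k ⁆ ∷_)) (λ v j → empty (⁅ k ⁆ ∷ v) (suc j))
                  λ v j left → cancel (⁅ k ⁆ ∷ v) (suc j)
                    λ { zero _ → ≡.refl ; (suc j′) (s≤s j′<j) → left j′ j′<j }) ⟩
    0# + f (⁅ k ⁆ ∷ Vec.replicate r ⁅ k ⁆)  ≈⟨ +-identityˡ _ ⟩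
    f (⁅ k ⁆ ∷ Vec.replicate r ⁅ k ⁆)       ∎
    where vs = vectors (subsets n) r

  -- The scan continues row by row: the sum over the later rows, as a function of the first row,
  -- satisfies the hypotheses of `∑-rows-cancel`, so only the constant first row survives.
  ∑-fillings-cancel : ∀ rs (c : Fin (length rs) → Fin n) (f : Filling n rs → Carrier) →
    (∀ T i j → ¬ Nonempty (entry T i j) → f T ≈ 0#) →
    (∀ T i j → ConstantBefore c T i j → c i ∉ entry T i j → Nonempty (entry T i j) →
      f T + f (insert T i j (c i)) ≈ 0#) →
    ∑ (fillings n rs) f ≈ f (constantRows rs c)
  ∑-fillings-cancel         []       c f empty cancel = +-identityʳ (f [])
  ∑-fillings-cancel {n = n} (r ∷ rs) c f empty cancel = begin
    ∑ (fillings n (r ∷ rs)) f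
      ≈⟨ ∑-cartesianProductWith _∷_ (vectors (subsets n) r) Ts f ⟩
    ∑ (vectors (subsets n) r) (λ v → ∑ Ts (f ∘ (v ∷_)))
      ≈⟨ ∑-rows-cancel r (c zero) _
           (λ v j v∌ → ∑-zero Ts λ T → empty (v ∷ T) zero j v∌)
           (λ v j left k∉ nonempty →
             trans (sym (∑-distrib-+ Ts _ _))
               (∑-zero Ts λ T → cancel (v ∷ T) zero j
                 (record { above = λ _ _ () ; left = left }) k∉ nonempty)) ⟩
    ∑ Ts (f ∘ (v₀ ∷_))
      ≈⟨ ∑-fillings-cancel rs (c ∘ suc) (f ∘ (v₀ ∷_))
           (λ T i → empty (v₀ ∷ T) (suc i))
           (λ T i j before → cancel (v₀ ∷ T) (suc i) j (shift before)) ⟩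
    f (constantRows (r ∷ rs) c)
      ∎
    where
    Ts = fillings n rs
    v₀ = Vec.replicate r ⁅ c zero ⁆

    -- The surviving first row is constant, so prepending it keeps all earlier boxes constant.
    shift : ∀ {T i j} → ConstantBefore (c ∘ suc) T i j → ConstantBefore c (v₀ ∷ T) (suc i) j
    shift before = record
      { above = λ { zero j′ _ → lookup-replicate j′ ⁅ c zero ⁆
                  ; (suc i′) j′ (s≤s i′<i) → above i′ j′ i′<i }
      ; left  = left
      }
      where open ConstantBefore before

-- The specialization of G

module Specialization {c ℓ} (R : CommutativeRing c ℓ) where

  open CommutativeRing R hiding (zero)
  open Summation R
  open Grothendieck R using (G)
  open Exp semiring using (_^_; ^-congʳ)
  open RawSemiringDefinitions (Semiring.rawSemiring semiring) using (product)
  open CommutativeMonoidSum *-commutativeMonoid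
    using (sum-cong-≋; sum-replicate-zero) renaming (∑-distrib-+ to product-distrib-*)
  open CommutativeSemigroupProperties *-commutativeSemigroup using () renaming (interchange to *-interchange)
  open RingProperties ring using (-1*x≈-x)
  open SetoidReasoning setoid

  product-const-∈ : ∀ (p : Subset n) β → product (λ k → if does (k ∈? p) then β else 1#) ≈ β ^ ∣ p ∣
  product-const-∈ []            β = refl
  product-const-∈ (inside  ∷ p) β = *-congˡ (product-const-∈ p β)
  product-const-∈ (outside ∷ p) β = trans (*-identityˡ _) (product-const-∈ p β)

  -- Double counting of the pairs of a box and an element in it: by element on the left, by box on
  -- the right.
  product-const-count : ∀ (ps : List (Subset n)) β →
    product (λ k → β ^ length (filter (k ∈?_) ps)) ≈ β ^ sum (map ∣_∣ ps)
  product-const-count {n} []       β = sum-replicate-zero n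
  product-const-count {n} (p ∷ ps) β = begin
    product (λ k → β ^ length (filter (k ∈?_) (p ∷ ps)))
      ≈⟨ sum-cong-≋ split ⟩
    product (λ k → (if does (k ∈? p) then β else 1#) * β ^ length (filter (k ∈?_) ps))
      ≈⟨ product-distrib-* (λ k → if does (k ∈? p) then β else 1#) _ ⟩
    product (λ k → if does (k ∈? p) then β else 1#) * product (λ k → β ^ length (filter (k ∈?_) ps))
      ≈⟨ *-cong (product-const-∈ p β) (product-const-count ps β) ⟩
    β ^ ∣ p ∣ * β ^ sum (map ∣_∣ ps)
      ≈⟨ Exp.^-homo-* semiring β ∣ p ∣ _ ⟨
    β ^ sum (map ∣_∣ (p ∷ ps))
      ∎
    where
    split : ∀ k → β ^ length (filter (k ∈?_) (p ∷ ps)) ≈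
                  (if does (k ∈? p) then β else 1#) * β ^ length (filter (k ∈?_) ps)
    split k with does (k ∈? p)
    ... | true  = refl
    ... | false = sym (*-identityˡ _)

  module _ (β γ : Carrier) (γβ≈-1 : γ * β ≈ - 1#) where

    term : Filling n rs → Carrier
    term {rs = rs} T = γ ^ (weight T ∸ sum rs) * product (λ k → β ^ ω T k)

    -- The separate `w` allows a computed value of the weight to enter both exponents at once.
    term-weight : ∀ (T : Filling n rs) {w} → weight T ≡ w → term T ≈ γ ^ (w ∸ sum rs) * β ^ w
    term-weight T ≡.refl = *-congˡ (product-const-count (boxes T) β)

    -- One more element contributes one factor `γ` and one factor `β`, hence a factor -1.
    term-insert : ∀ (T : Filling n rs) i j k → NonemptyEntries T → k ∉ entry T i j →
                  term T + term (insert T i j k) ≈ 0#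
    term-insert {rs = rs} T i j k nonempty k∉ = begin
      term T + term (insert T i j k)
        ≈⟨ +-cong (term-weight T ≡.refl)
                  (term-weight (insert T i j k) (weight-insert T i j k k∉)) ⟩
      γ ^ e * β ^ w + γ ^ (suc w ∸ sum rs) * β ^ suc w
        ≈⟨ +-congˡ (*-congʳ (^-congʳ γ (ℕ.+-∸-assoc 1 (size≤weight T nonempty)))) ⟩
      γ ^ e * β ^ w + (γ * γ ^ e) * (β * β ^ w)  ≈⟨ +-congˡ (*-interchange γ (γ ^ e) β (β ^ w)) ⟩
      γ ^ e * β ^ w + (γ * β) * (γ ^ e * β ^ w)  ≈⟨ +-congˡ (*-congʳ γβ≈-1) ⟩
      γ ^ e * β ^ w + - 1# * (γ ^ e * β ^ w)     ≈⟨ +-congˡ (-1*x≈-x _) ⟩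
      γ ^ e * β ^ w + - (γ ^ e * β ^ w)          ≈⟨ -‿inverseʳ _ ⟩
      0#                                         ∎
      where
      w = weight T
      e = w ∸ sum rs

    -- The scalars enter through `γ * β ≈ - 1#`, which makes sense in any commutative ring; the
    -- field case takes `γ` to be minus the inverse of `β`. After cancellation only the term of `T₀`
    -- is left, and its power of `γ` is trivial.
    G-specialized : ∀ (μ : Partition) → Partition.numParts μ ≤ n →
                    G μ {n} (λ _ → β) γ ≈ β ^ Partition.size μ
    G-specialized {n} μ numParts≤n = begin
      G μ {n} (λ _ → β) γ
        ≈⟨ ∑-filter isSetValuedTableau? (fillings n parts) term ⟩
      ∑ (fillings n parts) (λ T → when (isSetValuedTableau? T) (term T))
        ≈⟨ ∑-fillings-cancel parts row _
             (λ T i j T∌ → when-no (isSetValuedTableau? T) (λ (nonempty , _) → T∌ (nonempty i j)))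
             (λ T i j before k∉ nonempty →
               when-cancel (isSetValuedTableau? T) (isSetValuedTableau? (insert T i j (row i)))
                 (insert-tableau decreasing row toℕ-row T i j before)
                 (insert-tableau⁻ T i j (row i) nonempty)
                 (λ (nonempty , _) → term-insert T i j (row i) nonempty k∉)) ⟩
      when (isSetValuedTableau? T₀) (term T₀)
        ≈⟨ when-yes (isSetValuedTableau? T₀) (constantRows-tableau decreasing row toℕ-row) ⟩
      term T₀
        ≈⟨ term-weight T₀ (weight-constantRows parts row) ⟩
      γ ^ (size ∸ size) * β ^ size  ≈⟨ *-congʳ (^-congʳ γ (ℕ.n∸n≡0 size)) ⟩
      1# * β ^ size                 ≈⟨ *-identityˡ _ ⟩
      β ^ size                      ∎
      where
      open Partition μ
      -- The bound on the number of parts enters here: every row index must itself be available as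
      -- an entry.
      row : Fin (length parts) → Fin n
      row i = inject≤ i numParts≤n

      toℕ-row : ∀ i → toℕ (row i) ≡ toℕ i
      toℕ-row i = toℕ-inject≤ i numParts≤n

      T₀ : Filling n parts
      T₀ = constantRows parts row

theoremA1 : ∀ {c ℓ₁ ℓ₂} (F : HeytingField c ℓ₁ ℓ₂) → let open Field F in
    (n : ℕ) .{{_ : NonZero n}} →
    (μ : Partition) → Partition.numParts μ ≤ n →
    (β : Carrier) (β#0 : β # 0#) →
    G μ {n} (λ _ → β) (- inverse β#0) ≈ β ^ Partition.size μ
theoremA1 F n μ numParts≤n β β#0 =
  Specialization.G-specialized R β (- inverse β#0) -β⁻¹*β≈-1 μ numParts≤n
  where
  open Field F
  R = HeytingCommutativeRing.commutativeRing heytingCommutativeRing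
  open CommutativeRing R using (ring)
  open RingProperties ring using (-‿distribˡ-*)
  open SetoidReasoning setoid

  -β⁻¹*β≈-1 : - inverse β#0 * β ≈ - 1#
  -β⁻¹*β≈-1 = begin
    - inverse β#0 * β    ≈⟨ -‿distribˡ-* (inverse β#0) β ⟨
    - (inverse β#0 * β)  ≈⟨ -‿cong (*-comm (inverse β#0) β) ⟩
    - (β * inverse β#0)  ≈⟨ -‿cong (*-inverseʳ β#0) ⟩
    - 1#                 ∎
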